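{- Assume the following (conjectural) statement: there is an absolute constant $C$ such that for all integers $1\le k\le m$, every real multilinear polynomial $p(x_1,\dots,x_m)=\sum_{S\subseteq[m]}\lambda_S\prod_{i\in S}x_i$ with $\lambda_S<0$ for all $|S|>k$ has at most $C\,k\,2^m/\sqrt{m}$ zeroes on the hypercube $\{0,1\}^m$. Let $k(m)$ be a sequence of integers with $1\le k(m)<m$ (for $m\ge 2$) and $k(m)=o(\sqrt{m})$ as $m\to\infty$, and for each $m$ let $N=N(m)>(2^m)!$ be an integer and let $f^*=f^*_m:2^{[m]}\to\mathbb{R}$ be the set function with $f^*(\emptyset)=0$ whose $W$-coefficients are $w(S)=N$ for non-empty $S\subseteq[m]$ with $|S|\le k(m)$ and $w(S)=-1$ for $|S|>k(m)$. Then $f^*$ is $(1-o(1))$-far from coverage, i.e. the distance of $f^*_m$ to coverage tends to $1$ as $m\to\infty$.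
   Context: $[m]=\{1,\dots,m\}$. A function $f:2^{[m]}\to\mathbb{R}_{\ge 0}$ is a coverage function if there exist a finite set $U$, weights $w_u\ge 0$ for $u\in U$, and sets $A_1,\dots,A_m\subseteq U$ such that $f(T)=\sum_{u\in\bigcup_{i\in T}A_i} w_u$ for all $T\subseteq[m]$. The $W$-coefficients of a set function $f$ with $f(\emptyset)=0$ are, for each non-empty $S\subseteq[m]$, $w(S)=\sum_{T:\,S\cup T=[m]}(-1)^{|S\cap T|+1}f(T)$; equivalently they are the unique reals with $f(T)=\sum_{S:\,S\cap T\ne\emptyset}w(S)$ for all $T\subseteq[m]$. The distance of $f$ to coverage is the minimum over coverage functions $g:2^{[m]}\to\mathbb{R}_{\ge0}$ of $2^{ -m}\,|\{T\subseteq[m]: f(T)\ne g(T)\}|$. -}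

module Defs where

open import Algebra.Bundles using (CommutativeRing)
import Algebra.Properties.Semiring.Mult
import Algebra.Properties.Semiring.Exp
import Data.Bool.Properties as Bool
open import Data.Bool.Base using (if_then_else_)
open import Data.Fin.Base using (Fin)
open import Data.Fin.Subset using (Subset; inside; outside; ⊤; ⊥; _∪_; _∩_; ⋃; ∣_∣; Nonempty)
open import Data.Fin.Subset.Properties using (_∈?_)
open import Data.List.Base using (List; []; _∷_; _++_; map; foldr; filter; length; allFin)
open import Data.Nat.Base as ℕ using (ℕ; zero; suc)
open import Data.Product.Base using (Σ; ∃; ∃-syntax; _×_)
open import Data.Vec.Base as Vec using (lookup)
open import Data.Vec.Properties using (≡-dec)
open import Level using (0ℓ)
open import Relation.Binary.Core using (Rel)
open import Relation.Binary.PropositionalEquality.Core using (_≡_)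
open import Relation.Binary.Structures using (IsDecTotalOrder)
open import Relation.Binary.Definitions using (Decidable)
import Relation.Binary.Construct.NonStrictToStrict as ToStrict
open import Relation.Nullary using (¬_)
open import Relation.Nullary.Decidable using (¬?)
open import Relation.Unary using (Pred; Satisfiable)
import Relation.Unary as U

-- The reals are characterised, uniquely up to isomorphism in classical
-- logic, as a Dedekind-complete ordered field.  The operations _⁻¹ and sup
-- are total; nothing useful is specified about 0# ⁻¹, nor about the sup of
-- an empty or unbounded set.
record CompleteOrderedField : Set₁ where
  infix  4 _≤_
  infix  8 _⁻¹
  field
    commutativeRing : CommutativeRing 0ℓ 0ℓ

  open CommutativeRing commutativeRing public
    using (Carrier; _≈_; _+_; _*_; -_; _-_; 0#; 1#; semiring)

  field
    _≤_             : Rel Carrier 0ℓ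
    isDecTotalOrder : IsDecTotalOrder _≈_ _≤_
    +-monoˡ-≤       : ∀ {x y} z → x ≤ y → x + z ≤ y + z
    *-nonneg        : ∀ {x y} → 0# ≤ x → 0# ≤ y → 0# ≤ x * y

    0≉1             : ¬ 0# ≈ 1#
    _⁻¹             : Carrier → Carrier
    ⁻¹-cong         : ∀ {x y} → x ≈ y → x ⁻¹ ≈ y ⁻¹
    *-inverseʳ      : ∀ x → ¬ x ≈ 0# → x * x ⁻¹ ≈ 1#

  IsUpperBound : Pred Carrier 0ℓ → Carrier → Set
  IsUpperBound P b = ∀ x → P x → x ≤ b

  field
    sup             : Pred Carrier 0ℓ → Carrier
    sup-upper       : ∀ P → Satisfiable P → ∃ (IsUpperBound P) →
                      IsUpperBound P (sup P)
    sup-least       : ∀ P → Satisfiable P → ∃ (IsUpperBound P) →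
                      ∀ b → IsUpperBound P b → sup P ≤ b

  open IsDecTotalOrder isDecTotalOrder public using (_≟_; _≤?_)
  open ToStrict _≈_ _≤_ public using (_<_)
  open Algebra.Properties.Semiring.Exp semiring public using (_^_)

  private module Mult = Algebra.Properties.Semiring.Mult semiring

  fromℕ : ℕ → Carrier
  fromℕ n = n Mult.× 1#

  -- Meaningful for 0# ≤ x.
  √_ : Carrier → Carrier
  √ x = sup (λ y → y * y ≤ x)

subsets : ∀ m → List (Subset m)
subsets zero    = Vec.[] ∷ []
subsets (suc m) = map (outside Vec.∷_) (subsets m) ++ map (inside Vec.∷_) (subsets m)

elements : ∀ {n} → Subset n → List (Fin n)
elements {n} A = filter (_∈? A) (allFin n)

♯ : ∀ {m} {P : Pred (Subset m) 0ℓ} → U.Decidable P → ℕ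
♯ {m} P? = length (filter P? (subsets m))

infix 4 _≟ˢ_
_≟ˢ_ : ∀ {m} → Decidable {A = Subset m} _≡_
_≟ˢ_ = ≡-dec Bool._≟_

module Reals (ℝ : CompleteOrderedField) where

  open CompleteOrderedField ℝ

  ∑ ∏ : {A : Set} → List A → (A → Carrier) → Carrier
  ∑ xs f = foldr (λ x s → f x + s) 0# xs
  ∏ xs f = foldr (λ x s → f x * s) 1# xs

  infix 4 _⟶_
  _⟶_ : (ℕ → Carrier) → Carrier → Set
  d ⟶ l = ∀ ε → 0# < ε →
    ∃[ M ] (∀ m → M ℕ.≤ m → l - ε < d m × d m < l + ε)

  IsLittleO√ : (ℕ → ℕ) → Set
  IsLittleO√ k = ∀ ε → 0# < ε →
    ∃[ M ] (∀ m → M ℕ.≤ m → fromℕ (k m) ≤ ε * √ (fromℕ m))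

  -- A multilinear polynomial in m variables, given by its coefficients.
  MultilinearPolynomial : ℕ → Set
  MultilinearPolynomial m = Subset m → Carrier

  eval : ∀ {m} → MultilinearPolynomial m → (Fin m → Carrier) → Carrier
  eval {m} c x = ∑ (subsets m) λ S → c S * ∏ (elements S) x

  -- The vertices of {0,1}^m are encoded by Subset m = Vec Bool m.
  vertex : ∀ {m} → Subset m → Fin m → Carrier
  vertex v i = if lookup v i then 1# else 0#

  zeroesOnCube : ∀ {m} → MultilinearPolynomial m → ℕ
  zeroesOnCube p = ♯ (λ v → eval p (vertex v) ≟ 0#)

  FewZeroesConjecture : Set
  FewZeroesConjecture =
    Σ Carrier λ C → ∀ k m → 1 ℕ.≤ k → k ℕ.≤ m →
      (p : MultilinearPolynomial m) →
      (∀ S → k ℕ.< ∣ S ∣ → p S < 0#) →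
      fromℕ (zeroesOnCube p) ≤ C * fromℕ k * fromℕ (2 ℕ.^ m) * (√ (fromℕ m)) ⁻¹

  SetFunction : ℕ → Set
  SetFunction m = Subset m → Carrier

  -- The universe is Fin u, with weights w and sets A i ⊆ Fin u.
  -- Nonnegativity of f follows from that of the weights.
  IsCoverage : ∀ {m} → SetFunction m → Set
  IsCoverage {m} f =
    Σ ℕ λ u → Σ (Fin u → Carrier) λ w → Σ (Fin m → Subset u) λ A →
      (∀ j → 0# ≤ w j) ×
      (∀ T → f T ≈ ∑ (elements (⋃ (map A (elements T)))) w)

  -- Relevant for nonempty S and functions vanishing on the empty set.
  W-coefficient : ∀ {m} → SetFunction m → Subset m → Carrier
  W-coefficient {m} f S =
    ∑ (filter (λ T → S ∪ T ≟ˢ ⊤) (subsets m)) λ T →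
      (- 1#) ^ (∣ S ∩ T ∣ ℕ.+ 1) * f T

  disagreement : ∀ {m} → SetFunction m → SetFunction m → Carrier
  disagreement {m} f g =
    (fromℕ (2 ℕ.^ m)) ⁻¹ * fromℕ (♯ (λ T → ¬? (f T ≟ g T)))

  IsDistanceToCoverage : ∀ {m} → SetFunction m → Carrier → Set
  IsDistanceToCoverage {m} f d =
    (Σ (SetFunction m) λ g → IsCoverage g × d ≈ disagreement f g) ×
    (∀ (g : SetFunction m) → IsCoverage g → d ≤ disagreement f g)

  -- W-coefficients determine a function vanishing on ⊥, so this
  -- characterises f up to _≈_.
  IsF* : ∀ {m} → ℕ → ℕ → SetFunction m → Set
  IsF* k N f =
    f ⊥ ≈ 0# ×
    (∀ S → Nonempty S → ∣ S ∣ ℕ.≤ k → W-coefficient f S ≈ fromℕ N) ×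
    (∀ S → k ℕ.< ∣ S ∣ → W-coefficient f S ≈ - 1#)

{-# OPTIONS --safe #-}
module Submission where

-- For a coverage function g all W-coefficients at nonempty sets are
-- nonnegative, so those of h = f* - g at sets of size > k are negative.
-- By Möbius inversion the multilinear polynomial with coefficients w_h(S)
-- takes the value - h(∁ v) at the vertex v, so its zeroes count the sets on
-- which f* and g agree.  The conjecture bounds their fraction by C k / √m,
-- which tends to 0.

open import Defs
open import Algebra.Bundles using (CommutativeRing)
import Algebra.Properties.CommutativeSemigroup
import Algebra.Properties.Ring
import Algebra.Properties.Semiring.Mult
import Algebra.Solver.Ring.NaturalCoefficients.Default as Solver
open import Axiom.ExcludedMiddle using (ExcludedMiddle)
open import Data.Bool.Base using (true; false; if_then_else_; _∨_)
open import Data.Fin.Base using (Fin; zero; suc)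
open import Data.Fin.Subset using (Subset; inside; outside; ⊤; _∪_; _∩_; ⋃; ∣_∣; Nonempty; ∁)
open import Data.Fin.Subset.Properties using (_∈?_)
open import Data.List.Base using (List; []; _∷_; _++_; map; filter; length; allFin; tabulate)
open import Data.List.Properties using (filter-≐; filter-++; length-++; length-map; map-tabulate; map-∘)
open import Data.Nat.Base as ℕ using (ℕ; zero; suc; z≤n; s≤s; _!)
import Data.Nat.Properties as ℕ
open import Data.Product.Base using (Σ; ∃; _×_; _,_; proj₁; proj₂)
open import Data.Sum.Base using (inj₁; inj₂)
open import Data.Vec.Base as Vec using (lookup)
open import Data.Vec.Properties using (lookup-zipWith; lookup-replicate)
open import Function.Base using (_∘_; id)
open import Level using (0ℓ)
open import Relation.Binary.Bundles using (Poset)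
open import Relation.Binary.PropositionalEquality as ≡ using (_≡_; cong; cong₂)
import Relation.Binary.Reasoning.PartialOrder
open import Relation.Binary.Structures using (IsDecTotalOrder)
open import Relation.Nullary using (¬_; yes; no; does; contradiction)
open import Relation.Nullary.Decidable using (¬?)
open import Relation.Unary using (Pred; _≐_)
import Relation.Unary as U

-- Counting in lists and in the cube of subsets.

filter-map : ∀ {A B : Set} {P : Pred B 0ℓ} (P? : U.Decidable P) (h : A → B) xs →
             filter P? (map h xs) ≡ map h (filter (P? ∘ h) xs)
filter-map P? h []       = ≡.refl
filter-map P? h (x ∷ xs) with does (P? (h x))
... | true  = cong (h x ∷_) (filter-map P? h xs)
... | false = filter-map P? h xs

length-filter-¬ : ∀ {A : Set} {P : Pred A 0ℓ} (P? : U.Decidable P) xs →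
                  length (filter P? xs) ℕ.+ length (filter (¬? ∘ P?) xs) ≡ length xs
length-filter-¬ P? []       = ≡.refl
length-filter-¬ P? (x ∷ xs) with does (P? x)
... | true  = cong suc (length-filter-¬ P? xs)
... | false = ≡.trans (ℕ.+-suc _ _) (cong suc (length-filter-¬ P? xs))

length-subsets : ∀ m → length (subsets m) ≡ 2 ℕ.^ m
length-subsets zero    = ≡.refl
length-subsets (suc m) = begin
  length (map (outside Vec.∷_) (subsets m) ++ map (inside Vec.∷_) (subsets m))
    ≡⟨ length-++ (map (outside Vec.∷_) (subsets m)) ⟩
  length (map (outside Vec.∷_) (subsets m)) ℕ.+ length (map (inside Vec.∷_) (subsets m))
    ≡⟨ cong₂ ℕ._+_ (length-map _ (subsets m)) (length-map _ (subsets m)) ⟩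
  length (subsets m) ℕ.+ length (subsets m)
    ≡⟨ cong₂ ℕ._+_ (length-subsets m) (≡.trans (length-subsets m) (≡.sym (ℕ.+-identityʳ _))) ⟩
  2 ℕ.^ suc m ∎
  where open ≡.≡-Reasoning

♯-¬ : ∀ {m} {P : Pred (Subset m) 0ℓ} (P? : U.Decidable P) → ♯ P? ℕ.+ ♯ (¬? ∘ P?) ≡ 2 ℕ.^ m
♯-¬ {m} P? = ≡.trans (length-filter-¬ P? (subsets m)) (length-subsets m)

♯-cong : ∀ {m} {P Q : Pred (Subset m) 0ℓ} (P? : U.Decidable P) (Q? : U.Decidable Q) →
         P ≐ Q → ♯ P? ≡ ♯ Q?
♯-cong {m} P? Q? P≐Q = cong length (filter-≐ P? Q? P≐Q (subsets m))

♯-suc : ∀ {m} {P : Pred (Subset (suc m)) 0ℓ} (P? : U.Decidable P) →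
        ♯ P? ≡ ♯ (P? ∘ (outside Vec.∷_)) ℕ.+ ♯ (P? ∘ (inside Vec.∷_))
♯-suc {m} P? = begin
  length (filter P? (map (outside Vec.∷_) (subsets m) ++ map (inside Vec.∷_) (subsets m)))
    ≡⟨ cong length (filter-++ P? (map (outside Vec.∷_) (subsets m)) _) ⟩
  length (filter P? (map (outside Vec.∷_) (subsets m)) ++ filter P? (map (inside Vec.∷_) (subsets m)))
    ≡⟨ length-++ (filter P? (map (outside Vec.∷_) (subsets m))) ⟩
  length (filter P? (map (outside Vec.∷_) (subsets m))) ℕ.+
  length (filter P? (map (inside Vec.∷_) (subsets m)))
    ≡⟨ cong₂ ℕ._+_ (♯-map outside) (♯-map inside) ⟩
  ♯ (P? ∘ (outside Vec.∷_)) ℕ.+ ♯ (P? ∘ (inside Vec.∷_)) ∎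
  where
  open ≡.≡-Reasoning
  ♯-map : ∀ b → length (filter P? (map (b Vec.∷_) (subsets m))) ≡ ♯ (P? ∘ (b Vec.∷_))
  ♯-map b = ≡.trans (cong length (filter-map P? (b Vec.∷_) (subsets m)))
                    (length-map (b Vec.∷_) (filter (P? ∘ (b Vec.∷_)) (subsets m)))

-- Complementation swaps the subsets with and without the first element, so each inductive step only
-- exchanges two summands. It is needed because the value of the polynomial at `v` is tied to the
-- set function at `∁ v`.
♯-∁ : ∀ {m} {P : Pred (Subset m) 0ℓ} (P? : U.Decidable P) → ♯ (P? ∘ ∁) ≡ ♯ P?
♯-∁ {zero}  P? with does (P? Vec.[])
... | true  = ≡.refl
... | false = ≡.refl
♯-∁ {suc m} P? = begin
  ♯ (P? ∘ ∁)
    ≡⟨ ♯-suc (P? ∘ ∁) ⟩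
  ♯ (P? ∘ (inside Vec.∷_) ∘ ∁) ℕ.+ ♯ (P? ∘ (outside Vec.∷_) ∘ ∁)
    ≡⟨ cong₂ ℕ._+_ (♯-∁ (P? ∘ (inside Vec.∷_))) (♯-∁ (P? ∘ (outside Vec.∷_))) ⟩
  ♯ (P? ∘ (inside Vec.∷_)) ℕ.+ ♯ (P? ∘ (outside Vec.∷_))
    ≡⟨ ℕ.+-comm (♯ (P? ∘ (inside Vec.∷_))) _ ⟩
  ♯ (P? ∘ (outside Vec.∷_)) ℕ.+ ♯ (P? ∘ (inside Vec.∷_))
    ≡⟨ ♯-suc P? ⟨
  ♯ P? ∎
  where open ≡.≡-Reasoning

-- Elements of a subset, split at the first coordinate.

filter-∈-suc : ∀ {n} b (S : Subset n) →
               filter (_∈? (b Vec.∷ S)) (tabulate suc) ≡ map suc (elements S)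
filter-∈-suc b S = begin
  filter (_∈? (b Vec.∷ S)) (tabulate suc)
    ≡⟨ cong (filter (_∈? (b Vec.∷ S))) (map-tabulate id suc) ⟨
  filter (_∈? (b Vec.∷ S)) (map suc (allFin _))
    ≡⟨ filter-map (_∈? (b Vec.∷ S)) suc (allFin _) ⟩
  map suc (filter (λ i → suc i ∈? (b Vec.∷ S)) (allFin _))
    ≡⟨ cong (map suc) (filter-≐ _ (_∈? S) ((λ { (Vec.there p) → p }) , Vec.there) (allFin _)) ⟩
  map suc (elements S) ∎
  where open ≡.≡-Reasoning

elements-outside : ∀ {n} (S : Subset n) → elements (outside Vec.∷ S) ≡ map suc (elements S)
elements-outside = filter-∈-suc outside

elements-inside : ∀ {n} (S : Subset n) → elements (inside Vec.∷ S) ≡ zero ∷ map suc (elements S)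
elements-inside S = cong (zero ∷_) (filter-∈-suc inside S)

-- Turns a membership test into a Boolean lookup, which can be pushed through unions coordinatewise.
does-∈? : ∀ {n} (j : Fin n) S → does (j ∈? S) ≡ lookup S j
does-∈? zero    (true  Vec.∷ S) = ≡.refl
does-∈? zero    (false Vec.∷ S) = ≡.refl
does-∈? (suc j) (_ Vec.∷ S)     = does-∈? j S

card⇒nonempty : ∀ {n} (S : Subset n) → 0 ℕ.< ∣ S ∣ → Nonempty S
card⇒nonempty (inside Vec.∷ S)  _ = zero , Vec.here
card⇒nonempty (outside Vec.∷ S) p =
  let i , i∈S = card⇒nonempty S p in suc i , Vec.there i∈S

-- Well-ordering of the naturals for a decidable predicate; it is what makes the minimum in the
-- distance to coverage exist.
least : ∀ {P : Pred ℕ 0ℓ} → U.Decidable P → ∀ n → P n →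
        Σ ℕ λ k → P k × (∀ j → P j → k ℕ.≤ j)
least P? zero    p = zero , p , λ _ _ → z≤n
least P? (suc n) p with P? zero
... | yes p₀ = zero , p₀ , λ _ _ → z≤n
... | no ¬p₀ with least (P? ∘ suc) n p
...   | k , pₖ , min = suc k , pₖ ,
          λ { zero p₀ → contradiction p₀ ¬p₀ ; (suc j) pⱼ → s≤s (min j pⱼ) }

-- Arithmetic, order and square roots in a complete ordered field.

module OrderedField (ℝ : CompleteOrderedField) where

  open CompleteOrderedField ℝ
  open CommutativeRing commutativeRing public
    using (ring; commutativeSemiring; +-commutativeSemigroup; refl; sym; trans; reflexive;
           +-cong; +-congˡ; +-congʳ; *-congˡ; *-congʳ; -‿cong;
           +-identityˡ; +-identityʳ; +-assoc; +-comm; -‿inverseˡ; -‿inverseʳ;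
           *-identityˡ; *-identityʳ; *-assoc; *-comm; zeroˡ; zeroʳ; distribˡ; distribʳ)
  open Algebra.Properties.Ring ring public
    using (-‿+-comm; -‿involutive; -0#≈0#; -1*x≈-x; -‿distribˡ-*;
           x[y-z]≈xy-xz; +-cancelˡ; x∙y⁻¹≈ε⇒x≈y; x≈y⇒x∙y⁻¹≈ε)
  open Algebra.Properties.CommutativeSemigroup +-commutativeSemigroup public
    using (interchange)
  open Algebra.Properties.Semiring.Mult semiring using (×-homo-+)
  open IsDecTotalOrder isDecTotalOrder public
    using (isPartialOrder; total; antisym; ≤-respˡ-≈; ≤-respʳ-≈)
    renaming (refl to ≤-refl; trans to ≤-trans; reflexive to ≤-reflexive)

  poset : Poset 0ℓ 0ℓ 0ℓ
  poset = record { isPartialOrder = isPartialOrder }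

  module ≤-Reasoning = Relation.Binary.Reasoning.PartialOrder poset

  x-y+y≈x : ∀ x y → (x - y) + y ≈ x
  x-y+y≈x x y = trans (+-assoc _ _ _) (trans (+-congˡ (-‿inverseˡ y)) (+-identityʳ x))

  x+y-y≈x : ∀ x y → (x + y) - y ≈ x
  x+y-y≈x x y = trans (+-assoc _ _ _) (trans (+-congˡ (-‿inverseʳ y)) (+-identityʳ x))

  -0≈0 : ∀ {x} → x ≈ 0# → - x ≈ 0#
  -0≈0 x≈0 = trans (-‿cong x≈0) -0#≈0#

  +-mono-≤ : ∀ {x y u v} → x ≤ y → u ≤ v → x + u ≤ y + v
  +-mono-≤ {x} {y} {u} {v} x≤y u≤v = begin
    x + u ≤⟨ +-monoˡ-≤ u x≤y ⟩
    y + u ≈⟨ +-comm y u ⟩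
    u + y ≤⟨ +-monoˡ-≤ y u≤v ⟩
    v + y ≈⟨ +-comm v y ⟩
    y + v ∎
    where open ≤-Reasoning

  +-nonneg : ∀ {x y} → 0# ≤ x → 0# ≤ y → 0# ≤ x + y
  +-nonneg 0≤x 0≤y = ≤-respˡ-≈ (+-identityˡ 0#) (+-mono-≤ 0≤x 0≤y)

  neg-mono-≤ : ∀ {x y} → x ≤ y → - y ≤ - x
  neg-mono-≤ {x} {y} x≤y = begin
    - y             ≈⟨ +-identityˡ (- y) ⟨
    0# - y          ≈⟨ +-congʳ (-‿inverseʳ x) ⟨
    (x - x) - y     ≈⟨ +-assoc x (- x) (- y) ⟩
    x + (- x - y)   ≤⟨ +-monoˡ-≤ (- x - y) x≤y ⟩
    y + (- x - y)   ≈⟨ +-comm y _ ⟩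
    (- x - y) + y   ≈⟨ x-y+y≈x (- x) y ⟩
    - x             ∎
    where open ≤-Reasoning

  neg-mono-< : ∀ {x y} → x < y → - y < - x
  neg-mono-< (x≤y , x≉y) = neg-mono-≤ x≤y ,
    λ -y≈-x → x≉y (trans (sym (-‿involutive _)) (trans (-‿cong (sym -y≈-x)) (-‿involutive _)))

  +-monoʳ-< : ∀ {x y} z → x < y → z + x < z + y
  +-monoʳ-< z (x≤y , x≉y) = +-mono-≤ ≤-refl x≤y , x≉y ∘ +-cancelˡ z _ _

  x≤0⇒0≤-x : ∀ {x} → x ≤ 0# → 0# ≤ - x
  x≤0⇒0≤-x x≤0 = ≤-respˡ-≈ -0#≈0# (neg-mono-≤ x≤0)

  *-monoˡ-≤ : ∀ {x y z} → 0# ≤ z → x ≤ y → z * x ≤ z * y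
  *-monoˡ-≤ {x} {y} {z} 0≤z x≤y = begin
    z * x                     ≈⟨ +-identityˡ _ ⟨
    0# + z * x                ≤⟨ +-monoˡ-≤ (z * x) (*-nonneg 0≤z 0≤y-x) ⟩
    z * (y - x) + z * x       ≈⟨ +-congʳ (x[y-z]≈xy-xz z y x) ⟩
    (z * y - z * x) + z * x   ≈⟨ x-y+y≈x (z * y) (z * x) ⟩
    z * y                     ∎
    where
    open ≤-Reasoning
    0≤y-x : 0# ≤ y - x
    0≤y-x = ≤-respˡ-≈ (-‿inverseʳ x) (+-monoˡ-≤ (- x) x≤y)

  *-monoʳ-≤ : ∀ {x y z} → 0# ≤ z → x ≤ y → x * z ≤ y * z
  *-monoʳ-≤ {x} {y} {z} 0≤z x≤y = begin
    x * z ≈⟨ *-comm x z ⟩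
    z * x ≤⟨ *-monoˡ-≤ 0≤z x≤y ⟩
    z * y ≈⟨ *-comm z y ⟩
    y * z ∎
    where open ≤-Reasoning

  -- If `1# ≤ 0#`, then `- 1#` is nonnegative, and so is its square, which is `1#`.
  0≤1 : 0# ≤ 1#
  0≤1 with total 0# 1#
  ... | inj₁ 0≤1 = 0≤1
  ... | inj₂ 1≤0 = begin
    0#          ≤⟨ *-nonneg (x≤0⇒0≤-x 1≤0) (x≤0⇒0≤-x 1≤0) ⟩
    - 1# * - 1# ≈⟨ -1*x≈-x (- 1#) ⟩
    - - 1#      ≈⟨ -‿involutive 1# ⟩
    1#          ∎
    where open ≤-Reasoning

  0<1 : 0# < 1#
  0<1 = 0≤1 , 0≉1

  0<⇒≉0 : ∀ {x} → 0# < x → ¬ x ≈ 0#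
  0<⇒≉0 (_ , 0≉x) = 0≉x ∘ sym

  -- A nonpositive inverse, multiplied by `x`, would give `1# ≤ 0#`.
  ⁻¹-nonneg : ∀ {x} → 0# < x → 0# ≤ x ⁻¹
  ⁻¹-nonneg {x} 0<x with total 0# (x ⁻¹)
  ... | inj₁ 0≤x⁻¹ = 0≤x⁻¹
  ... | inj₂ x⁻¹≤0 = contradiction (antisym 0≤1 1≤0) 0≉1
    where
    open ≤-Reasoning
    1≤0 : 1# ≤ 0#
    1≤0 = begin
      1#       ≈⟨ *-inverseʳ x (0<⇒≉0 0<x) ⟨
      x * x ⁻¹ ≤⟨ *-monoˡ-≤ (proj₁ 0<x) x⁻¹≤0 ⟩
      x * 0#   ≈⟨ zeroʳ x ⟩
      0#       ∎

  *-inverseˡ : ∀ {x} → 0# < x → x ⁻¹ * x ≈ 1#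
  *-inverseˡ {x} 0<x = trans (*-comm _ _) (*-inverseʳ x (0<⇒≉0 0<x))

  fromℕ-+ : ∀ a b → fromℕ (a ℕ.+ b) ≈ fromℕ a + fromℕ b
  fromℕ-+ = ×-homo-+ 1#

  fromℕ-nonneg : ∀ n → 0# ≤ fromℕ n
  fromℕ-nonneg zero    = ≤-refl
  fromℕ-nonneg (suc n) = +-nonneg 0≤1 (fromℕ-nonneg n)

  fromℕ-mono-≤ : ∀ {a b} → a ℕ.≤ b → fromℕ a ≤ fromℕ b
  fromℕ-mono-≤ {b = b} z≤n = fromℕ-nonneg b
  fromℕ-mono-≤ (s≤s a≤b) = +-mono-≤ ≤-refl (fromℕ-mono-≤ a≤b)

  1≤fromℕ : ∀ {n} → 1 ℕ.≤ n → 1# ≤ fromℕ n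
  1≤fromℕ 1≤n = ≤-respˡ-≈ (+-identityʳ 1#) (fromℕ-mono-≤ 1≤n)

  1≤⇒0< : ∀ {x} → 1# ≤ x → 0# < x
  1≤⇒0< {x} 1≤x = begin-strict
    0# <⟨ 0<1 ⟩
    1# ≤⟨ 1≤x ⟩
    x  ∎
    where open ≤-Reasoning

  -- The number `1#` lies in the set whose supremum is the root. That set is bounded by `x`: if
  -- `x ≤ y`, then `1# ≤ y`, hence `y ≤ y * y ≤ x`. The result makes `√ (fromℕ m)` invertible for
  -- positive `m`.
  1≤√ : ∀ {x} → 1# ≤ x → 1# ≤ √ x
  1≤√ {x} 1≤x = sup-upper (λ y → y * y ≤ x) (1# , 1*1≤x) (x , bound) 1# 1*1≤x
    where
    open ≤-Reasoning
    1*1≤x : 1# * 1# ≤ x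
    1*1≤x = ≤-respˡ-≈ (sym (*-identityˡ 1#)) 1≤x
    bound : IsUpperBound (λ y → y * y ≤ x) x
    bound y yy≤x with total y x
    ... | inj₁ y≤x = y≤x
    ... | inj₂ x≤y = begin
      y      ≈⟨ *-identityʳ y ⟨
      y * 1# ≤⟨ *-monoˡ-≤ (≤-trans 0≤1 1≤y) 1≤y ⟩
      y * y  ≤⟨ yy≤x ⟩
      x      ∎
      where
      1≤y : 1# ≤ y
      1≤y = ≤-trans 1≤x x≤y

-- Finite sums, W-coefficients and Möbius inversion on the cube.

module W-Inversion (ℝ : CompleteOrderedField) where

  open CompleteOrderedField ℝ
  open Reals ℝ
  open OrderedField ℝ

  ∑-cong : ∀ {A : Set} (xs : List A) {f g : A → Carrier} →
           (∀ x → f x ≈ g x) → ∑ xs f ≈ ∑ xs g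
  ∑-cong []       f≈g = refl
  ∑-cong (x ∷ xs) f≈g = +-cong (f≈g x) (∑-cong xs f≈g)

  ∑-0 : ∀ {A : Set} (xs : List A) {f : A → Carrier} → (∀ x → f x ≈ 0#) → ∑ xs f ≈ 0#
  ∑-0 []       f≈0 = refl
  ∑-0 (x ∷ xs) f≈0 = trans (+-cong (f≈0 x) (∑-0 xs f≈0)) (+-identityˡ 0#)

  ∑-+ : ∀ {A : Set} (xs : List A) (f g : A → Carrier) →
        ∑ xs (λ x → f x + g x) ≈ ∑ xs f + ∑ xs g
  ∑-+ []       f g = sym (+-identityˡ 0#)
  ∑-+ (x ∷ xs) f g = trans (+-congˡ (∑-+ xs f g)) (interchange _ _ _ _)

  ∑-neg : ∀ {A : Set} (xs : List A) (f : A → Carrier) → ∑ xs (λ x → - f x) ≈ - ∑ xs f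
  ∑-neg []       f = sym -0#≈0#
  ∑-neg (x ∷ xs) f = trans (+-congˡ (∑-neg xs f)) (-‿+-comm _ _)

  ∑-++ : ∀ {A : Set} (xs ys : List A) (f : A → Carrier) → ∑ (xs ++ ys) f ≈ ∑ xs f + ∑ ys f
  ∑-++ []       ys f = sym (+-identityˡ _)
  ∑-++ (x ∷ xs) ys f = trans (+-congˡ (∑-++ xs ys f)) (sym (+-assoc _ _ _))

  ∑-map : ∀ {A B : Set} (h : A → B) xs (f : B → Carrier) → ∑ (map h xs) f ≈ ∑ xs (f ∘ h)
  ∑-map h []       f = refl
  ∑-map h (x ∷ xs) f = +-congˡ (∑-map h xs f)

  ∏-map : ∀ {A B : Set} (h : A → B) xs (f : B → Carrier) → ∏ (map h xs) f ≈ ∏ xs (f ∘ h)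
  ∏-map h []       f = refl
  ∏-map h (x ∷ xs) f = *-congˡ (∏-map h xs f)

  ∑-filter : ∀ {A : Set} {P : Pred A 0ℓ} (P? : U.Decidable P) xs (f : A → Carrier) →
             ∑ (filter P? xs) f ≈ ∑ xs (λ x → if does (P? x) then f x else 0#)
  ∑-filter P? []       f = refl
  ∑-filter P? (x ∷ xs) f with does (P? x)
  ... | true  = +-congˡ (∑-filter P? xs f)
  ... | false = trans (∑-filter P? xs f) (sym (+-identityˡ _))

  ∑-subsets-suc : ∀ {m} (f : Subset (suc m) → Carrier) →
                  ∑ (subsets (suc m)) f ≈
                  ∑ (subsets m) (f ∘ (outside Vec.∷_)) + ∑ (subsets m) (f ∘ (inside Vec.∷_))
  ∑-subsets-suc {m} f = trans (∑-++ (map (outside Vec.∷_) (subsets m)) _ f)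
    (+-cong (∑-map (outside Vec.∷_) (subsets m) f) (∑-map (inside Vec.∷_) (subsets m) f))

  if-then-0-neg : ∀ b {x y} → x ≈ - y →
                  (if b then x else 0#) ≈ - (if b then y else 0#)
  if-then-0-neg true  x≈-y = x≈-y
  if-then-0-neg false x≈-y = sym -0#≈0#

  -- Recursion and linearity of the W-coefficients.

  W : ∀ {m} → SetFunction m → Subset m → Carrier
  W = W-coefficient

  -- The filter condition is moved into the summand, so that the sum runs over all subsets and can
  -- be split at the first coordinate.
  W-term : ∀ {m} → SetFunction m → Subset m → Subset m → Carrier
  W-term f S T = if does (S ∪ T ≟ˢ ⊤) then (- 1#) ^ (∣ S ∩ T ∣ ℕ.+ 1) * f T else 0#

  W-∑ : ∀ {m} (f : SetFunction m) S → W f S ≈ ∑ (subsets m) (W-term f S)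
  W-∑ {m} f S = ∑-filter (λ T → S ∪ T ≟ˢ ⊤) (subsets m) _

  -- When `S` omits the first element, `S ∪ T ≡ ⊤` forces `T` to contain it; the intersection
  -- `S ∩ T`, and with it the sign, is unaffected.
  W-outside : ∀ {m} (f : SetFunction (suc m)) S →
              W f (outside Vec.∷ S) ≈ W (f ∘ (inside Vec.∷_)) S
  W-outside {m} f S = begin-equality
    W f (outside Vec.∷ S)
      ≈⟨ W-∑ f (outside Vec.∷ S) ⟩
    ∑ (subsets (suc m)) (W-term f (outside Vec.∷ S))
      ≈⟨ ∑-subsets-suc (W-term f (outside Vec.∷ S)) ⟩
    -- For `T` without the first element the test for `⊤` fails at the head, so the summand computes
    -- to `0#`.
    ∑ (subsets m) (λ _ → 0#) + ∑ (subsets m) (W-term (f ∘ (inside Vec.∷_)) S)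
      ≈⟨ +-congʳ (∑-0 (subsets m) (λ _ → refl)) ⟩
    0# + ∑ (subsets m) (W-term (f ∘ (inside Vec.∷_)) S)
      ≈⟨ +-identityˡ _ ⟩
    ∑ (subsets m) (W-term (f ∘ (inside Vec.∷_)) S)
      ≈⟨ W-∑ (f ∘ (inside Vec.∷_)) S ⟨
    W (f ∘ (inside Vec.∷_)) S ∎
    where open ≤-Reasoning

  -- When `S` contains the first element, `T` may contain it or not. If it does, `∣ S ∩ T ∣` grows
  -- by one and the sign flips, which produces the difference.
  W-inside : ∀ {m} (f : SetFunction (suc m)) S →
             W f (inside Vec.∷ S) ≈ W (f ∘ (outside Vec.∷_)) S - W (f ∘ (inside Vec.∷_)) S
  W-inside {m} f S = begin-equality
    W f (inside Vec.∷ S)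
      ≈⟨ W-∑ f (inside Vec.∷ S) ⟩
    ∑ (subsets (suc m)) (W-term f (inside Vec.∷ S))
      ≈⟨ ∑-subsets-suc (W-term f (inside Vec.∷ S)) ⟩
    ∑ (subsets m) (W-term f₀ S) + ∑ (subsets m) (W-term f (inside Vec.∷ S) ∘ (inside Vec.∷_))
      ≈⟨ +-congˡ (∑-cong (subsets m) (λ T → if-then-0-neg (does (S ∪ T ≟ˢ ⊤)) (sign-flip T))) ⟩
    ∑ (subsets m) (W-term f₀ S) + ∑ (subsets m) (λ T → - W-term f₁ S T)
      ≈⟨ +-congˡ (∑-neg (subsets m) (W-term f₁ S)) ⟩
    ∑ (subsets m) (W-term f₀ S) - ∑ (subsets m) (W-term f₁ S)
      ≈⟨ +-cong (W-∑ f₀ S) (-‿cong (W-∑ f₁ S)) ⟨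
    W f₀ S - W f₁ S ∎
    where
    open ≤-Reasoning
    f₀ f₁ : SetFunction m
    f₀ = f ∘ (outside Vec.∷_)
    f₁ = f ∘ (inside Vec.∷_)
    sign-flip : ∀ T → (- 1# * (- 1#) ^ (∣ S ∩ T ∣ ℕ.+ 1)) * f₁ T ≈
                      - ((- 1#) ^ (∣ S ∩ T ∣ ℕ.+ 1) * f₁ T)
    sign-flip T = trans (*-assoc _ _ _) (-1*x≈-x _)

  W-[] : (f : SetFunction 0) → W f Vec.[] ≈ - f Vec.[]
  W-[] f = begin-equality
    (- 1# * 1#) * f Vec.[] + 0# ≈⟨ +-identityʳ _ ⟩
    (- 1# * 1#) * f Vec.[]      ≈⟨ *-congʳ (*-identityʳ (- 1#)) ⟩
    - 1# * f Vec.[]             ≈⟨ -1*x≈-x _ ⟩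
    - f Vec.[]                  ∎
    where open ≤-Reasoning

  W-cong : ∀ {m} {f g : SetFunction m} → (∀ T → f T ≈ g T) → ∀ S → W f S ≈ W g S
  W-cong {m} f≈g S = ∑-cong (filter (λ T → S ∪ T ≟ˢ ⊤) (subsets m)) (λ T → *-congˡ (f≈g T))

  W-0 : ∀ {m} {f : SetFunction m} → (∀ T → f T ≈ 0#) → ∀ S → W f S ≈ 0#
  W-0 {m} f≈0 S = ∑-0 (filter (λ T → S ∪ T ≟ˢ ⊤) (subsets m))
    (λ T → trans (*-congˡ (f≈0 T)) (zeroʳ _))

  W-+ : ∀ {m} (f g : SetFunction m) S → W (λ T → f T + g T) S ≈ W f S + W g S
  W-+ {m} f g S = trans
    (∑-cong (filter (λ T → S ∪ T ≟ˢ ⊤) (subsets m)) (λ T → distribˡ _ (f T) (g T)))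
    (∑-+ (filter (λ T → S ∪ T ≟ˢ ⊤) (subsets m)) _ _)

  -- Follows from additivity applied to `f = (f - g) + g`.
  W-- : ∀ {m} (f g : SetFunction m) S → W (λ T → f T - g T) S ≈ W f S - W g S
  W-- f g S = begin-equality
    W (λ T → f T - g T) S                     ≈⟨ x+y-y≈x _ (W g S) ⟨
    (W (λ T → f T - g T) S + W g S) - W g S   ≈⟨ +-congʳ (W-+ _ g S) ⟨
    W (λ T → (f T - g T) + g T) S - W g S     ≈⟨ +-congʳ (W-cong (λ T → x-y+y≈x (f T) (g T)) S) ⟩
    W f S - W g S                             ∎
    where open ≤-Reasoning

  -- At the first element of `S` the recursion takes the difference of two equal restrictions. For
  -- empty `S` no such cancellation occurs.
  W-const : ∀ {m} {c} {S : Subset m} → Nonempty S → W (λ _ → c) S ≈ 0#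
  W-const {S = inside Vec.∷ S}  _                    = trans (W-inside _ S) (-‿inverseʳ _)
  W-const {S = outside Vec.∷ S} (suc i , Vec.there p) = trans (W-outside _ S) (W-const (i , p))

  -- Values of multilinear polynomials at the vertices of the cube.

  monomial : ∀ {m} → Subset m → (Fin m → Carrier) → Carrier
  monomial S x = ∏ (elements S) x

  monomial-outside : ∀ {m} (S : Subset m) x →
                     monomial (outside Vec.∷ S) x ≈ monomial S (x ∘ suc)
  monomial-outside S x =
    trans (reflexive (cong (λ xs → ∏ xs x) (elements-outside S))) (∏-map suc (elements S) x)

  monomial-inside : ∀ {m} (S : Subset m) x →
                    monomial (inside Vec.∷ S) x ≈ x zero * monomial S (x ∘ suc)
  monomial-inside S x =
    trans (reflexive (cong (λ xs → ∏ xs x) (elements-inside S))) (*-congˡ (∏-map suc (elements S) x))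

  eval-outside : ∀ {m} (p : MultilinearPolynomial (suc m)) v →
                 eval p (vertex (outside Vec.∷ v)) ≈ eval (p ∘ (outside Vec.∷_)) (vertex v)
  eval-outside {m} p v = begin-equality
    eval p (vertex (outside Vec.∷ v))
      ≈⟨ ∑-subsets-suc {m} _ ⟩
    _ ≈⟨ +-cong (∑-cong (subsets m) (λ S → *-congˡ (monomial-outside S _)))
                (∑-0 (subsets m) (λ S → trans (*-congˡ (trans (monomial-inside S _) (zeroˡ _))) (zeroʳ _))) ⟩
    eval (p ∘ (outside Vec.∷_)) (vertex v) + 0#
      ≈⟨ +-identityʳ _ ⟩
    eval (p ∘ (outside Vec.∷_)) (vertex v) ∎
    where open ≤-Reasoning

  eval-inside : ∀ {m} (p : MultilinearPolynomial (suc m)) v →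
                eval p (vertex (inside Vec.∷ v)) ≈
                eval (p ∘ (outside Vec.∷_)) (vertex v) + eval (p ∘ (inside Vec.∷_)) (vertex v)
  eval-inside {m} p v = trans (∑-subsets-suc {m} _)
    (+-cong (∑-cong (subsets m) (λ S → *-congˡ (monomial-outside S _)))
            (∑-cong (subsets m) (λ S → *-congˡ (trans (monomial-inside S _) (*-identityˡ _)))))

  eval-cong : ∀ {m} {p q : MultilinearPolynomial m} → (∀ S → p S ≈ q S) →
              ∀ x → eval p x ≈ eval q x
  eval-cong {m} p≈q x = ∑-cong (subsets m) (λ S → *-congʳ (p≈q S))

  eval-- : ∀ {m} (p q : MultilinearPolynomial m) x →
           eval (λ S → p S - q S) x ≈ eval p x - eval q x
  eval-- {m} p q x = begin-equality
    eval (λ S → p S - q S) x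
      ≈⟨ ∑-cong (subsets m) (λ S → trans (distribʳ _ _ _) (+-congˡ (sym (-‿distribˡ-* _ _)))) ⟩
    ∑ (subsets m) (λ S → p S * monomial S x - q S * monomial S x)
      ≈⟨ ∑-+ (subsets m) _ _ ⟩
    eval p x + ∑ (subsets m) (λ S → - (q S * monomial S x))
      ≈⟨ +-congˡ (∑-neg (subsets m) _) ⟩
    eval p x - eval q x ∎
    where open ≤-Reasoning

  -- Möbius inversion on the complemented cube: w(S) is minus the Möbius
  -- transform of Q ↦ f (∁ Q).  The coefficient at S = ⊥ is included.
  eval-W : ∀ {m} (f : SetFunction m) v → eval (W f) (vertex v) ≈ - f (∁ v)
  eval-W f Vec.[] = trans (+-identityʳ _) (trans (*-identityʳ _) (W-[] f))
  eval-W f (outside Vec.∷ v) = begin-equality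
    eval (W f) (vertex (outside Vec.∷ v))              ≈⟨ eval-outside (W f) v ⟩
    eval (W f ∘ (outside Vec.∷_)) (vertex v)           ≈⟨ eval-cong (W-outside f) _ ⟩
    eval (W (f ∘ (inside Vec.∷_))) (vertex v)          ≈⟨ eval-W (f ∘ (inside Vec.∷_)) v ⟩
    - f (inside Vec.∷ ∁ v)                             ∎
    where open ≤-Reasoning
  eval-W f (inside Vec.∷ v) = begin-equality
    eval (W f) (vertex (inside Vec.∷ v))
      ≈⟨ eval-inside (W f) v ⟩
    eval (W f ∘ (outside Vec.∷_)) (vertex v) + eval (W f ∘ (inside Vec.∷_)) (vertex v)
      ≈⟨ +-cong (eval-cong (W-outside f) _) (trans (eval-cong (W-inside f) _) (eval-- (W f₀) (W f₁) _)) ⟩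
    eval (W f₁) (vertex v) + (eval (W f₀) (vertex v) - eval (W f₁) (vertex v))
      ≈⟨ +-comm _ _ ⟩
    (eval (W f₀) (vertex v) - eval (W f₁) (vertex v)) + eval (W f₁) (vertex v)
      ≈⟨ x-y+y≈x _ _ ⟩
    eval (W f₀) (vertex v)
      ≈⟨ eval-W f₀ v ⟩
    - f (outside Vec.∷ ∁ v) ∎
    where
    open ≤-Reasoning
    f₀ f₁ : SetFunction _
    f₀ = f ∘ (outside Vec.∷_)
    f₁ = f ∘ (inside Vec.∷_)

  -- By `eval-W`, a vertex `v` is a zero exactly when `f` and `g` agree at `∁ v`, and
  -- complementation preserves the count.
  zeroesOnCube-W : ∀ {m} (f g : SetFunction m) →
                   zeroesOnCube (W (λ T → f T - g T)) ≡ ♯ (λ T → f T ≟ g T)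
  zeroesOnCube-W f g = ≡.trans
    (♯-cong _ ((λ T → f T ≟ g T) ∘ ∁)
      ( (λ {v} z → x∙y⁻¹≈ε⇒x≈y _ _ (trans (sym (-‿involutive _)) (-0≈0 (trans (sym (eval-W h v)) z))))
      , (λ {v} f≈g → trans (eval-W h v) (-0≈0 (x≈y⇒x∙y⁻¹≈ε f≈g)))))
    (♯-∁ (λ T → f T ≟ g T))
    where
    h : SetFunction _
    h T = f T - g T

-- Nonnegativity of the W-coefficients of coverage functions.

module Coverage (ℝ : CompleteOrderedField) where

  open CompleteOrderedField ℝ
  open Reals ℝ
  open OrderedField ℝ
  open W-Inversion ℝ

  module _ {u : ℕ} where

    covered : ∀ {m} → (Fin m → Subset u) → Subset m → Subset u
    covered A T = ⋃ (map A (elements T))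

    covered-outside : ∀ {m} (A : Fin (suc m) → Subset u) T →
                      covered A (outside Vec.∷ T) ≡ covered (A ∘ suc) T
    covered-outside A T = cong ⋃
      (≡.trans (cong (map A) (elements-outside T)) (≡.sym (map-∘ (elements T))))

    covered-inside : ∀ {m} (A : Fin (suc m) → Subset u) T →
                     covered A (inside Vec.∷ T) ≡ A zero ∪ covered (A ∘ suc) T
    covered-inside A T = ≡.trans (cong (⋃ ∘ map A) (elements-inside T))
      (cong (λ xs → A zero ∪ ⋃ xs) (≡.sym (map-∘ (elements T))))

    -- The contribution of a point `j` of weight `c` to a coverage function is `c` minus this. The
    -- complementary form is convenient because fixing the first coordinate leaves either a function
    -- of the same kind or zero.
    missed : ∀ {m} → Carrier → (Fin m → Subset u) → Fin u → SetFunction m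
    missed c A j T = if lookup (covered A T) j then 0# else c

    missed-outside : ∀ {m} c (A : Fin (suc m) → Subset u) j T →
                     missed c A j (outside Vec.∷ T) ≈ missed c (A ∘ suc) j T
    missed-outside c A j T =
      reflexive (cong (λ X → if lookup X j then 0# else c) (covered-outside A T))

    missed-inside : ∀ {m} c (A : Fin (suc m) → Subset u) j T →
                    missed c A j (inside Vec.∷ T) ≈
                    (if lookup (A zero) j then 0# else missed c (A ∘ suc) j T)
    missed-inside c A j T = trans
      (reflexive (cong (λ b → if b then 0# else c)
        (≡.trans (cong (λ X → lookup X j) (covered-inside A T))
                 (lookup-zipWith _∨_ j (A zero) (covered (A ∘ suc) T)))))
      (if-∨ (lookup (A zero) j))
      where
      if-∨ : ∀ b {b′} → (if b ∨ b′ then 0# else c) ≈ (if b then 0# else (if b′ then 0# else c))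
      if-∨ true  = refl
      if-∨ false = refl

    -- The coefficient is `- c` at the one set `S` of all `i` with `j` in `A i`, and zero elsewhere.
    -- At each coordinate, if `S` disagrees with that set the coefficient vanishes, and otherwise
    -- the recursion continues with `A ∘ suc`.
    W-missed-≤0 : ∀ {m c} → 0# ≤ c → (A : Fin m → Subset u) → ∀ j S → W (missed c A j) S ≤ 0#
    W-missed-≤0 {c = c} 0≤c A j Vec.[] = begin
      W (missed c A j) Vec.[]   ≈⟨ W-[] (missed c A j) ⟩
      - missed c A j Vec.[]     ≡⟨ cong (λ b → - (if b then 0# else c)) (lookup-replicate j outside) ⟩
      - c                       ≤⟨ neg-mono-≤ 0≤c ⟩
      - 0#                      ≈⟨ -0#≈0# ⟩
      0#                        ∎
      where open ≤-Reasoning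
    W-missed-≤0 {c = c} 0≤c A j (b Vec.∷ S)
      with lookup (A zero) j | missed-inside c A j | b
    ... | true  | in≈ | outside = ≤-reflexive (trans (W-outside _ S) (W-0 in≈ S))
    ... | false | in≈ | outside = ≤-respˡ-≈
      (sym (trans (W-outside _ S) (W-cong in≈ S)))
      (W-missed-≤0 0≤c (A ∘ suc) j S)
    ... | true  | in≈ | inside  = ≤-respˡ-≈
      (sym (trans (W-inside _ S) (trans
        (+-cong (W-cong (missed-outside c A j) S) (-0≈0 (W-0 in≈ S)))
        (+-identityʳ _))))
      (W-missed-≤0 0≤c (A ∘ suc) j S)
    ... | false | in≈ | inside  = ≤-reflexive (trans (W-inside _ S) (trans
      (+-cong (W-cong (missed-outside c A j) S) (-‿cong (W-cong in≈ S)))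
      (-‿inverseʳ _)))

  W-∑-nonneg : ∀ {m} {J : Set} (xs : List J) (φ : J → SetFunction m) S →
               (∀ j → 0# ≤ W (φ j) S) → 0# ≤ W (λ T → ∑ xs (λ j → φ j T)) S
  W-∑-nonneg []       φ S 0≤W = ≤-reflexive (sym (W-0 (λ _ → refl) S))
  W-∑-nonneg (x ∷ xs) φ S 0≤W = ≤-respʳ-≈ (sym (W-+ (φ x) _ S))
    (+-nonneg (0≤W x) (W-∑-nonneg xs φ S 0≤W))

  -- A coverage function is the sum over points `j` of `w j` minus `missed (w j) A j`. At nonempty
  -- `S` the constant contributes nothing, and the subtracted part has a nonpositive coefficient.
  W-coverage-nonneg : ∀ {m} {g : SetFunction m} → IsCoverage g →
                      ∀ {S} → Nonempty S → 0# ≤ W g S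
  W-coverage-nonneg {m} {g} (u , w , A , 0≤w , g≈) {S} S≠∅ =
    ≤-respʳ-≈ (sym (W-cong g≈∑ S)) (W-∑-nonneg (allFin u) _ S 0≤W)
    where
    if-complement : ∀ b c → (if b then c else 0#) ≈ c - (if b then 0# else c)
    if-complement true  c = sym (trans (+-congˡ -0#≈0#) (+-identityʳ c))
    if-complement false c = sym (-‿inverseʳ c)

    g≈∑ : ∀ T → g T ≈ ∑ (allFin u) (λ j → w j - missed (w j) A j T)
    g≈∑ T = trans (g≈ T) (trans (∑-filter (_∈? covered A T) (allFin u) w)
      (∑-cong (allFin u) (λ j → trans
        (reflexive (cong (λ b → if b then w j else 0#) (does-∈? j (covered A T))))
        (if-complement _ (w j)))))

    0≤W : ∀ j → 0# ≤ W (λ T → w j - missed (w j) A j T) S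
    0≤W j = ≤-respʳ-≈
      (sym (trans (W-- _ _ S) (trans (+-congʳ (W-const S≠∅)) (+-identityˡ _))))
      (x≤0⇒0≤-x (W-missed-≤0 (0≤w j) A j S))

  -- Realised over the empty universe; it shows that the minimum over coverage functions is taken
  -- over a nonempty family.
  zero-isCoverage : ∀ {m} → IsCoverage {m} (λ _ → 0#)
  zero-isCoverage = 0 , (λ ()) , (λ _ → Vec.[]) , (λ ()) , (λ _ → refl)

-- Agreement counts and the distance to coverage.

module Distance (em : ExcludedMiddle 0ℓ) (ℝ : CompleteOrderedField) where

  open CompleteOrderedField ℝ
  open Reals ℝ
  open OrderedField ℝ
  open W-Inversion ℝ
  open Coverage ℝ
  open Solver commutativeSemiring using (solve; _:*_; _:=_)

  agreement : ∀ {m} → SetFunction m → SetFunction m → ℕ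
  agreement f g = ♯ (λ T → f T ≟ g T)

  cube : ℕ → Carrier
  cube m = fromℕ (2 ℕ.^ m)

  0<cube : ∀ m → 0# < cube m
  0<cube m = 1≤⇒0< (1≤fromℕ (ℕ.m^n>0 2 m))

  -- Agreements and disagreements together exhaust the `2 ℕ.^ m` subsets.
  disagreement≈ : ∀ {m} (f g : SetFunction m) →
                  disagreement f g ≈ 1# - cube m ⁻¹ * fromℕ (agreement f g)
  disagreement≈ {m} f g = begin-equality
    cube m ⁻¹ * fromℕ D
      ≈⟨ x+y-y≈x _ _ ⟨
    (cube m ⁻¹ * fromℕ D + cube m ⁻¹ * fromℕ (agreement f g)) - cube m ⁻¹ * fromℕ (agreement f g)
      ≈⟨ +-congʳ total≈1 ⟩
    1# - cube m ⁻¹ * fromℕ (agreement f g) ∎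
    where
    open ≤-Reasoning
    D : ℕ
    D = ♯ (λ T → ¬? (f T ≟ g T))
    total≈1 : cube m ⁻¹ * fromℕ D + cube m ⁻¹ * fromℕ (agreement f g) ≈ 1#
    total≈1 = begin-equality
      cube m ⁻¹ * fromℕ D + cube m ⁻¹ * fromℕ (agreement f g)
        ≈⟨ +-comm _ _ ⟩
      cube m ⁻¹ * fromℕ (agreement f g) + cube m ⁻¹ * fromℕ D
        ≈⟨ distribˡ _ _ _ ⟨
      cube m ⁻¹ * (fromℕ (agreement f g) + fromℕ D)
        ≈⟨ *-congˡ (fromℕ-+ (agreement f g) D) ⟨
      cube m ⁻¹ * fromℕ (agreement f g ℕ.+ D)
        ≡⟨ cong (λ n → cube m ⁻¹ * fromℕ n) (♯-¬ (λ T → f T ≟ g T)) ⟩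
      cube m ⁻¹ * cube m
        ≈⟨ *-inverseˡ (0<cube m) ⟩
      1# ∎

  disagreement≤1 : ∀ {m} (f g : SetFunction m) → disagreement f g ≤ 1#
  disagreement≤1 {m} f g = begin
    disagreement f g                         ≈⟨ disagreement≈ f g ⟩
    1# - cube m ⁻¹ * fromℕ (agreement f g)   ≤⟨ +-mono-≤ ≤-refl (neg-mono-≤ 0≤fraction) ⟩
    1# - 0#                                  ≈⟨ +-congˡ -0#≈0# ⟩
    1# + 0#                                  ≈⟨ +-identityʳ 1# ⟩
    1#                                       ∎
    where
    open ≤-Reasoning
    0≤fraction : 0# ≤ cube m ⁻¹ * fromℕ (agreement f g)
    0≤fraction = *-nonneg (⁻¹-nonneg (0<cube m)) (fromℕ-nonneg (agreement f g))

  agreement≤⇒≤disagreement : ∀ {m t} (f g : SetFunction m) →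
    fromℕ (agreement f g) ≤ t * cube m → 1# - t ≤ disagreement f g
  agreement≤⇒≤disagreement {m} {t} f g A≤ = begin
    1# - t                                   ≤⟨ +-mono-≤ ≤-refl (neg-mono-≤ fraction≤t) ⟩
    1# - cube m ⁻¹ * fromℕ (agreement f g)   ≈⟨ disagreement≈ f g ⟨
    disagreement f g                         ∎
    where
    open ≤-Reasoning
    fraction≤t : cube m ⁻¹ * fromℕ (agreement f g) ≤ t
    fraction≤t = begin
      cube m ⁻¹ * fromℕ (agreement f g) ≤⟨ *-monoˡ-≤ (⁻¹-nonneg (0<cube m)) A≤ ⟩
      cube m ⁻¹ * (t * cube m)          ≈⟨ solve 3 (λ i t c → i :* (t :* c) := t :* (i :* c)) refl _ t _ ⟩
      t * (cube m ⁻¹ * cube m)          ≈⟨ *-congˡ (*-inverseˡ (0<cube m)) ⟩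
      t * 1#                            ≈⟨ *-identityʳ t ⟩
      t                                 ∎

  -- The minimum is attained because disagreement counts are natural numbers: a least attained count
  -- exists, and scaling by the inverse of the cube size preserves the order.
  distanceToCoverage : ∀ {m} (f : SetFunction m) → ∃ (IsDistanceToCoverage f)
  distanceToCoverage {m} f =
    let n , (g , g-cov , ♯≡n) , minimal =
          -- Excluded middle decides whether a count is attained; the search is bounded by the count
          -- of the zero function.
          least {Attained} (λ _ → em) _ ((λ _ → 0#) , zero-isCoverage , ≡.refl)
    in disagreement f g , (g , g-cov , refl) , λ g′ g′-cov →
       *-monoˡ-≤ (⁻¹-nonneg (0<cube m))
         (fromℕ-mono-≤ (ℕ.≤-trans (ℕ.≤-reflexive ♯≡n) (minimal _ (g′ , g′-cov , ≡.refl))))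
    where
    Attained : ℕ → Set
    Attained n = Σ (SetFunction m) λ g → IsCoverage g × ♯ (λ T → ¬? (f T ≟ g T)) ≡ n

  -- Subtracting the nonnegative W-coefficients of g keeps those of f on
  -- large sets negative, so the conjecture applies to the polynomial with
  -- coefficients W (f - g), whose zeroes are the agreements of f and g.
  agreement-bound : ((C , _) : FewZeroesConjecture) →
    ∀ {k m} → 1 ℕ.≤ k → k ℕ.≤ m → (f g : SetFunction m) →
    (∀ S → k ℕ.< ∣ S ∣ → W f S < 0#) → IsCoverage g →
    fromℕ (agreement f g) ≤ C * fromℕ k * cube m * (√ (fromℕ m)) ⁻¹
  agreement-bound (C , few) {k} {m} 1≤k k≤m f g Wf<0 g-cov =
    ≤-respˡ-≈ (reflexive (cong fromℕ (zeroesOnCube-W f g))) (few k m 1≤k k≤m _ W<0)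
    where
    open ≤-Reasoning
    W<0 : ∀ S → k ℕ.< ∣ S ∣ → W (λ T → f T - g T) S < 0#
    W<0 S k<∣S∣ = begin-strict
      W (λ T → f T - g T) S ≈⟨ W-- f g S ⟩
      W f S - W g S         ≤⟨ +-mono-≤ ≤-refl (neg-mono-≤ 0≤Wg) ⟩
      W f S - 0#            ≈⟨ trans (+-congˡ -0#≈0#) (+-identityʳ _) ⟩
      W f S                 <⟨ Wf<0 S k<∣S∣ ⟩
      0#                    ∎
      where
      0≤Wg : 0# ≤ W g S
      0≤Wg = W-coverage-nonneg g-cov (card⇒nonempty S (ℕ.≤-trans (s≤s z≤n) k<∣S∣))

  -- Inserting `k ≤ δ √m` into the bound cancels the square root against its inverse. The constant
  -- `C` is first enlarged to a nonnegative `B`, since multiplying the inequality for `k` by it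
  -- requires a sign.
  agreement-small : ((C , _) : FewZeroesConjecture) → ∀ {B δ} → C ≤ B → 0# ≤ B →
    ∀ {k m} → 1 ℕ.≤ k → k ℕ.≤ m → fromℕ k ≤ δ * √ (fromℕ m) →
    (f g : SetFunction m) → (∀ S → k ℕ.< ∣ S ∣ → W f S < 0#) → IsCoverage g →
    fromℕ (agreement f g) ≤ B * δ * cube m
  agreement-small conj@(C , _) {B} {δ} C≤B 0≤B {k} {m} 1≤k k≤m k≤δ√m f g Wf<0 g-cov = begin
    fromℕ (agreement f g)
      ≤⟨ agreement-bound conj 1≤k k≤m f g Wf<0 g-cov ⟩
    C * fromℕ k * cube m * s ⁻¹
      ≤⟨ *-monoʳ-≤ (⁻¹-nonneg 0<s) (*-monoʳ-≤ (proj₁ (0<cube m)) Ck≤Bδs) ⟩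
    B * (δ * s) * cube m * s ⁻¹
      ≈⟨ solve 5 (λ b d s c i → b :* (d :* s) :* c :* i := b :* d :* c :* (s :* i)) refl B δ s _ _ ⟩
    B * δ * cube m * (s * s ⁻¹)
      ≈⟨ *-congˡ (*-inverseʳ s (0<⇒≉0 0<s)) ⟩
    B * δ * cube m * 1#
      ≈⟨ *-identityʳ _ ⟩
    B * δ * cube m ∎
    where
    open ≤-Reasoning
    s : Carrier
    s = √ (fromℕ m)
    0<s : 0# < s
    0<s = 1≤⇒0< (1≤√ (1≤fromℕ (ℕ.≤-trans 1≤k k≤m)))
    Ck≤Bδs : C * fromℕ k ≤ B * (δ * s)
    Ck≤Bδs = begin
      C * fromℕ k ≤⟨ *-monoʳ-≤ (fromℕ-nonneg k) C≤B ⟩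
      B * fromℕ k ≤⟨ *-monoˡ-≤ 0≤B k≤δ√m ⟩
      B * (δ * s) ∎

  -- The conjecture gives no sign for its constant, so the larger of `C` and `1#` is taken.
  positive-bound : ∀ C → ∃ λ B → C ≤ B × 0# < B
  positive-bound C with total C 1#
  ... | inj₁ C≤1 = 1# , C≤1 , 0<1
  ... | inj₂ 1≤C = C , ≤-refl , 1≤⇒0< 1≤C

  -- The witness is ε/(2B), so that `B * δ` is half of `ε`; doubling is written `B + B`.
  small-multiplier : ∀ {B ε} → 0# < B → 0# < ε → ∃ λ δ → 0# < δ × B * δ < ε
  small-multiplier {B} {ε} 0<B 0<ε = δ , (0≤δ , δ≉0 ∘ sym) , Bδ<ε
    where
    open ≤-Reasoning
    0<B+B : 0# < B + B
    0<B+B = begin-strict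
      0#     <⟨ 0<B ⟩
      B      ≈⟨ +-identityʳ B ⟨
      B + 0# ≤⟨ +-mono-≤ ≤-refl (proj₁ 0<B) ⟩
      B + B  ∎
    δ : Carrier
    δ = ε * (B + B) ⁻¹
    0≤δ : 0# ≤ δ
    0≤δ = *-nonneg (proj₁ 0<ε) (⁻¹-nonneg 0<B+B)
    Bδ+Bδ≈ε : B * δ + B * δ ≈ ε
    Bδ+Bδ≈ε = begin-equality
      B * δ + B * δ                ≈⟨ distribʳ δ B B ⟨
      (B + B) * (ε * (B + B) ⁻¹)   ≈⟨ solve 3 (λ b e i → b :* (e :* i) := e :* (b :* i)) refl _ ε _ ⟩
      ε * ((B + B) * (B + B) ⁻¹)   ≈⟨ *-congˡ (*-inverseʳ _ (0<⇒≉0 0<B+B)) ⟩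
      ε * 1#                       ≈⟨ *-identityʳ ε ⟩
      ε                            ∎
    Bδ≉0 : ¬ B * δ ≈ 0#
    Bδ≉0 Bδ≈0 = 0<⇒≉0 0<ε (trans (sym Bδ+Bδ≈ε) (trans (+-cong Bδ≈0 Bδ≈0) (+-identityˡ 0#)))
    δ≉0 : ¬ δ ≈ 0#
    δ≉0 δ≈0 = Bδ≉0 (trans (*-congˡ δ≈0) (zeroʳ B))
    Bδ<ε : B * δ < ε
    Bδ<ε = (begin
      B * δ          ≈⟨ +-identityʳ _ ⟨
      B * δ + 0#     ≤⟨ +-mono-≤ ≤-refl (*-nonneg (proj₁ 0<B) 0≤δ) ⟩
      B * δ + B * δ  ≈⟨ Bδ+Bδ≈ε ⟩
      ε              ∎)
      -- If `B * δ` equalled `ε`, which is twice `B * δ`, subtracting one copy would give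
      -- `B * δ ≈ 0#`.
      , λ Bδ≈ε → Bδ≉0 (trans (sym (x+y-y≈x _ (B * δ))) (trans (+-congʳ Bδ+Bδ≈ε) (x≈y⇒x∙y⁻¹≈ε (sym Bδ≈ε))))

-- Convergence of the distance of `f*` to 1.

lemma4p4 : ExcludedMiddle 0ℓ →
    (ℝ : CompleteOrderedField) →
    let open CompleteOrderedField ℝ
        open Reals ℝ in
    FewZeroesConjecture →
    (k : ℕ → ℕ) →
    (∀ m → 2 ℕ.≤ m → 1 ℕ.≤ k m × k m ℕ.< m) →
    IsLittleO√ k →
    (N : ℕ → ℕ) →
    (∀ m → 2 ℕ.≤ m → (2 ℕ.^ m) ! ℕ.< N m) →
    (f* : ∀ m → SetFunction m) →
    (∀ m → 2 ℕ.≤ m → IsF* (k m) (N m) (f* m)) →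
    Σ (ℕ → Carrier) λ d →
      (∀ m → IsDistanceToCoverage (f* m) (d m)) × d ⟶ 1#
lemma4p4 em ℝ conj k k-bounds k-littleO N _ f* isF* =
  d , (λ m → proj₂ (distanceToCoverage (f* m))) , d⟶1
  where
  open CompleteOrderedField ℝ
  open Reals ℝ
  open OrderedField ℝ
  open Distance em ℝ

  d : ℕ → Carrier
  d m = proj₁ (distanceToCoverage (f* m))

  W<0 : ∀ m → 2 ℕ.≤ m → ∀ S → k m ℕ.< ∣ S ∣ → W-coefficient (f* m) S < 0#
  W<0 m 2≤m S k<∣S∣ = let _ , _ , W≈-1 = isF* m 2≤m in begin-strict
    W-coefficient (f* m) S   ≈⟨ W≈-1 S k<∣S∣ ⟩
    - 1#                     <⟨ neg-mono-< 0<1 ⟩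
    - 0#                     ≈⟨ -0#≈0# ⟩
    0#                       ∎
    where open ≤-Reasoning

  d⟶1 : d ⟶ 1#
  d⟶1 ε 0<ε =
    let B , C≤B , 0<B = positive-bound (proj₁ conj)
        δ , 0<δ , Bδ<ε = small-multiplier 0<B 0<ε
        M , k≤δ√ = k-littleO δ 0<δ
    -- Beyond `M` the little-o estimate with `δ` holds; from 2 on, the hypotheses on `k m` and
    -- `f* m` apply.
    in M ℕ.⊔ 2 , λ m M⊔2≤m →
      let open ≤-Reasoning
          2≤m = ℕ.≤-trans (ℕ.m≤n⊔m M 2) M⊔2≤m
          1≤k , k<m = k-bounds m 2≤m
          -- Here `g` is a closest coverage function, so bounds on its disagreement with `f* m` are
          -- bounds on `d m`.
          (g , g-cov , d≈) , _ = proj₂ (distanceToCoverage (f* m))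
          agreement≤ = agreement-small conj C≤B (proj₁ 0<B) 1≤k (ℕ.<⇒≤ k<m)
                         (k≤δ√ m (ℕ.≤-trans (ℕ.m≤m⊔n M 2) M⊔2≤m)) (f* m) g (W<0 m 2≤m) g-cov
      in (begin-strict
           1# - ε                  <⟨ +-monoʳ-< 1# (neg-mono-< Bδ<ε) ⟩
           1# - B * δ              ≤⟨ agreement≤⇒≤disagreement (f* m) g agreement≤ ⟩
           disagreement (f* m) g   ≈⟨ d≈ ⟨
           d m                     ∎)
       , (begin-strict
           d m                     ≈⟨ d≈ ⟩
           disagreement (f* m) g   ≤⟨ disagreement≤1 (f* m) g ⟩
           1#                      ≈⟨ +-identityʳ 1# ⟨
           1# + 0#                 <⟨ +-monoʳ-< 1# 0<ε ⟩
           1# + ε                  ∎)
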